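{- Let $p\geq 4$ be an integer and $c=\sqrt{2+\sqrt{2}}$. Then for every positive integer $n$, $\mathrm{conv}^{\leq p}_{\mathcal F}(n) \leq \left\lceil \frac{n-1}{p-c\sqrt{p}}\right\rceil$.
   Context: All graphs are finite and simple. In an oriented graph, the inversion of a vertex set $X$ reverses the orientation of every arc with both endvertices in $X$; a $(\leq p)$-inversion is the inversion of a set of at most $p$ vertices. For a graph $G$, $\mathrm{conv}^{\leq p}(G)$ is the minimum number of $(\leq p)$-inversions transforming an orientation of $G$ into its converse (all arcs reversed); this does not depend on the chosen orientation. $\mathrm{conv}^{\leq p}_{\mathcal F}(n)$ is the maximum of $\mathrm{conv}^{\leq p}(F)$ over all forests $F$ of order $n$. -}

module Defs where

open import Data.Nat using (ℕ; zero; suc; _+_; _*_; _∸_; _^_; _≤_)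
open import Data.Bool using (Bool; true; false; not; _∧_; if_then_else_)
open import Data.Fin using (Fin; zero; suc; inject₁; fromℕ)
open import Data.Vec using (Vec; lookup; count)
open import Data.List using (List; foldl; length)
open import Data.List.Relation.Unary.All using (All)
open import Data.Product using (Σ; _×_; ∃)
open import Relation.Binary.PropositionalEquality using (_≡_)
open import Relation.Nullary using (¬_)
open import Function.Definitions using (Injective)
open import Data.Bool.Properties using (T?)

record Graph (n : ℕ) : Set where
  field
    Adj   : Fin n → Fin n → Bool
    sym   : ∀ u v → Adj u v ≡ Adj v u
    irrefl : ∀ u → Adj u u ≡ false
open Graph public

record Cycle {n : ℕ} (G : Graph n) : Set where
  field
    m      : ℕ
    f      : Fin (suc (suc (suc m))) → Fin n
    inj    : Injective _≡_ _≡_ f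
    step   : ∀ (i : Fin (suc (suc m))) → Adj G (f (inject₁ i)) (f (suc i)) ≡ true
    close  : Adj G (f (fromℕ (suc (suc m)))) (f zero) ≡ true

IsForest : {n : ℕ} → Graph n → Set
IsForest G = ¬ Cycle G

record Orientation {n : ℕ} (G : Graph n) : Set where
  field
    Arc     : Fin n → Fin n → Bool
    onEdges : ∀ u v → Arc u v ≡ true → Adj G u v ≡ true
    oneWay  : ∀ u v → Adj G u v ≡ true → Arc u v ≡ not (Arc v u)
open Orientation public

ArcRel : ℕ → Set
ArcRel n = Fin n → Fin n → Bool

VSet : ℕ → Set
VSet n = Vec Bool n

size : {n : ℕ} → VSet n → ℕ
size X = count T? X

invert : {n : ℕ} → ArcRel n → VSet n → ArcRel n
invert A X u v = if (lookup X u ∧ lookup X v) then A v u else A u v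

converse : {n : ℕ} → ArcRel n → ArcRel n
converse A u v = A v u

ConvAtMost : {n : ℕ} {G : Graph n} → Orientation G → ℕ → ℕ → Set
ConvAtMost {n} O p k =
  Σ (List (VSet n)) λ Xs →
    (length Xs ≤ k) × All (λ X → size X ≤ p) Xs ×
    (∀ u v → foldl invert (Arc O) Xs u v ≡ converse (Arc O) u v)

-- For p ≥ 4 (so p - c√p > 0, c = √(2+√2)) and natural k:
--   k ≥ (n-1)/(p - c√p)
-- ⟺ k p - (n-1) ≥ k c √p
-- ⟺ A := k p - (n-1) ≥ 0  and  A² ≥ (2+√2) k² p
-- ⟺ A ≥ 0, B := A² - 2k²p ≥ 0  and  B² ≥ 2 k⁴ p².
CeilBound : ℕ → ℕ → ℕ → Set
CeilBound p n k =
  (n ∸ 1 ≤ k * p) ×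
  (2 * (k ^ 2) * p ≤ (k * p ∸ (n ∸ 1)) ^ 2) ×
  (2 * (k ^ 4) * (p ^ 2) ≤ (((k * p ∸ (n ∸ 1)) ^ 2) ∸ 2 * (k ^ 2) * p) ^ 2)

{-# OPTIONS --safe #-}
-- A family of sets reverses every arc exactly once (mod 2) iff every edge lies
-- in an odd number of them, so extra edges do no harm and the forest may be
-- completed to a tree T with n − 1 edges. The key claim: if 2g < (d + 1)² and T
-- has at least g edges, there is a set X of at most g vertices that induces at
-- least g − d edges whose deletion leaves a tree plus isolated vertices. Take a
-- lowest vertex v whose subtree T_v has more than d vertices, so that all
-- branches at v have at most d. If T_v has more than g vertices, v together with
-- greedily chosen branches at v will do. Otherwise put all of T_v in X, which
-- loses a single edge, and continue with g − |T_v| and d − 1 in T − T_v.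
-- For g = p and d = ⌊√(2p)⌋ this removes at least p − √(2p) edges with each set.
module Submission where

open import Defs hiding (sym; size)
open import Data.Bool using (Bool; true; false; _∧_; _xor_; if_then_else_)
import Data.Bool.Properties as Bool
open import Data.Empty using (⊥)
open import Data.Fin as Fin using (Fin; zero; suc; inject₁; fromℕ)
open import Data.Fin.Properties using (injective⇒≤)
open import Data.List using (List; []; _∷_; _++_; length; lookup; map; foldl; allFin)
open import Data.List.Membership.Propositional using (_∈_; _∉_; find; lose)
open import Data.List.Membership.Propositional.Properties using (∈-++⁺ˡ; ∈-++⁺ʳ; ∈-++⁻; ∈-∃++; ∈-lookup; ∈-allFin)
import Data.List.Membership.DecPropositional as DecMembership
open import Data.List.Properties using (++-assoc; ++-identityʳ; length-++; length-map; length-tabulate)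
open import Data.List.Relation.Binary.Disjoint.Propositional using (Disjoint)
open import Data.List.Relation.Binary.Permutation.Propositional using (_↭_; ↭-refl; ↭-reflexive; ↭-sym; ↭-trans; prep; ↭⇒↭ₛ)
open import Data.List.Relation.Binary.Permutation.Propositional.Properties using (∈-resp-↭; ↭-length; shift; shifts; ++⁺ˡ; ++⁺ʳ)
open import Data.List.Relation.Binary.Permutation.Setoid.Properties using () renaming (Unique-resp-↭ to Unique-resp-↭ₛ)
open import Data.List.Relation.Unary.All as All using (All; []; _∷_; all?)
open import Data.List.Relation.Unary.All.Properties using (¬All⇒Any¬) renaming (map⁺ to All-map⁺)
open import Data.List.Relation.Unary.AllPairs using ([]; _∷_)
open import Data.List.Relation.Unary.Any using (Any; here; there; any?)
open import Data.List.Relation.Unary.Linked using (Linked; [-]; _∷_)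
open import Data.List.Relation.Unary.Unique.Propositional using (Unique)
open import Data.List.Relation.Unary.Unique.Propositional.Properties using (allFin⁺) renaming (++⁺ to Unique-++⁺)
open import Data.Nat using (ℕ; zero; suc; _+_; _*_; _∸_; _^_; _≤_; _<_; z≤n; s≤s; s≤s⁻¹; _≤?_; _<?_)
open import Data.Nat.Properties
open import Data.Nat.Tactic.RingSolver using (solve-∀)
open import Data.Product using (∃-syntax; _×_; _,_; proj₁; proj₂)
open import Data.Sum as Sum using (_⊎_; inj₁; inj₂)
open import Data.Vec as Vec using (_[_]≔_)
open import Data.Vec.Properties using (lookup∘update; lookup∘update′; lookup-replicate)
open import Function.Definitions using (Injective)
open import Relation.Binary.Definitions using (DecidableEquality)
open import Relation.Binary.PropositionalEquality using (_≡_; _≢_; refl; sym; trans; cong; cong₂; subst; setoid)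
open import Relation.Nullary using (¬_; Dec; yes; no; does; contradiction; ¬?; _×-dec_)
open import Relation.Nullary.Decidable using (dec-true; dec-false; decidable-stable)

-- Duplicate-free lists up to permutation.

module _ {B : Set} where

  Unique-resp-↭ : {xs ys : List B} → xs ↭ ys → Unique xs → Unique ys
  Unique-resp-↭ σ = Unique-resp-↭ₛ (setoid B) (↭⇒↭ₛ σ)

  Unique-++⁻ : (xs : List B) {ys : List B} → Unique (xs ++ ys) → Unique xs × Unique ys × Disjoint xs ys
  Unique-++⁻ [] u = [] , u , λ ()
  Unique-++⁻ (x ∷ xs) (x∉ ∷ u) =
    let uxs , uys , xs#ys = Unique-++⁻ xs u
    in All.tabulate (λ m → All.lookup x∉ (∈-++⁺ˡ m)) ∷ uxs , uys ,
       λ { (here refl , m) → All.lookup x∉ (∈-++⁺ʳ xs m) refl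
         ; (there l , m) → xs#ys (l , m) }

  -- The form needed when a piece with labels `xs` is cut out of a tree with root `x`: the root
  -- stays with the remainder `ys`.
  Unique-∷-split : ∀ {x : B} {zs} xs {ys} → zs ↭ xs ++ ys → Unique (x ∷ zs) →
                   Unique xs × Unique (x ∷ ys) × Disjoint xs (x ∷ ys)
  Unique-∷-split {x} xs {ys} σ u =
    Unique-++⁻ xs (Unique-resp-↭ (↭-trans (prep x σ) (↭-sym (shift x xs ys))) u)

  Unique-∷⁺ : ∀ {x : B} {xs} → x ∉ xs → Unique xs → Unique (x ∷ xs)
  Unique-∷⁺ x∉xs u = All.tabulate (λ { m refl → x∉xs m }) ∷ u

  Unique-head-∉ : ∀ {x : B} {xs} → Unique (x ∷ xs) → x ∉ xs
  Unique-head-∉ (x∉ ∷ _) m = All.lookup x∉ m refl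

  -- Induction step for moving the entries `gs` of a plugged-in piece to the front when the hole
  -- lies below the first branch; `↭-insertʳ` is the step for a hole among the later siblings.
  ↭-insertˡ : ∀ gs {z : B} {xs ys} zs → xs ↭ gs ++ ys → z ∷ xs ++ zs ↭ gs ++ z ∷ ys ++ zs
  ↭-insertˡ gs {z} {ys = ys} zs σ =
    ↭-trans (prep z (↭-trans (++⁺ʳ zs σ) (↭-reflexive (++-assoc gs ys zs))))
            (↭-sym (shift z gs (ys ++ zs)))

  ↭-insertʳ : ∀ gs {z : B} {xs ys} zs → xs ↭ gs ++ ys → z ∷ zs ++ xs ↭ gs ++ z ∷ zs ++ ys
  ↭-insertʳ gs {z} zs σ =
    ↭-trans (prep z (↭-trans (++⁺ˡ zs σ) (shifts zs gs)))
            (↭-sym (shift z gs _))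

-- Rooted trees, their vertices and edges.

-- A rooted tree is a root together with the ordered list of its branches, in
-- first-child / next-sibling form: in `branch v cs ss`, the branches `cs` hang
-- at `v` and `ss` are the siblings of `v`.
data Branches (A : Set) : Set where
  ∅      : Branches A
  branch : A → Branches A → Branches A → Branches A

module _ {A : Set} where

  labels : Branches A → List A
  labels ∅                = []
  labels (branch v cs ss) = v ∷ labels cs ++ labels ss

  edges : A → Branches A → List (A × A)
  edges p ∅                = []
  edges p (branch v cs ss) = (p , v) ∷ edges v cs ++ edges p ss

  size : Branches A → ℕ
  size F = length (labels F)

  infixr 5 _⊕_
  _⊕_ : Branches A → Branches A → Branches A
  ∅              ⊕ H = H
  branch v cs ss ⊕ H = branch v cs (ss ⊕ H)

  labels-⊕ : ∀ G H → labels (G ⊕ H) ≡ labels G ++ labels H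
  labels-⊕ ∅ H = refl
  labels-⊕ (branch v cs ss) H =
    cong (v ∷_) (trans (cong (labels cs ++_) (labels-⊕ ss H)) (sym (++-assoc (labels cs) _ _)))

  edges-⊕ : ∀ p G H → edges p (G ⊕ H) ≡ edges p G ++ edges p H
  edges-⊕ p ∅ H = refl
  edges-⊕ p (branch v cs ss) H =
    cong ((p , v) ∷_) (trans (cong (edges v cs ++_) (edges-⊕ p ss H)) (sym (++-assoc (edges v cs) _ _)))

  edge-ends : ∀ p F {u w} → (u , w) ∈ edges p F → u ∈ p ∷ labels F × w ∈ labels F
  edge-ends p (branch v cs ss) (here refl) = here refl , here refl
  edge-ends p (branch v cs ss) (there m) with ∈-++⁻ (edges v cs) m
  ... | inj₁ l = let u∈ , w∈ = edge-ends v cs l in there (∈-++⁺ˡ {xs = v ∷ labels cs} u∈) , there (∈-++⁺ˡ w∈)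
  ... | inj₂ r with edge-ends p ss r
  ...   | here refl , w∈ = here refl , there (∈-++⁺ʳ (labels cs) w∈)
  ...   | there u∈ , w∈ = there (there (∈-++⁺ʳ (labels cs) u∈)) , there (∈-++⁺ʳ (labels cs) w∈)

  -- Contexts: cutting out and attaching subtrees.

  -- The hole takes a list of branches rather than one branch, so plugging `∅` deletes a subtree and
  -- plugging a single vertex attaches a leaf. Whatever fills the hole hangs at `site`.
  data Context : Set where
    here    : Branches A → Context
    child   : A → Context → Branches A → Context
    sibling : A → Branches A → Context → Context

  plug : Context → Branches A → Branches A
  plug (here ss)        G = G ⊕ ss
  plug (child v C ss)   G = branch v (plug C G) ss
  plug (sibling v cs C) G = branch v cs (plug C G)

  site : A → Context → A
  site p (here ss)        = p
  site p (child v C ss)   = site v C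
  site p (sibling v cs C) = site p C

  labels-plug : ∀ C G → labels (plug C G) ↭ labels G ++ labels (plug C ∅)
  labels-plug (here ss)        G = ↭-reflexive (labels-⊕ G ss)
  labels-plug (child v C ss)   G = ↭-insertˡ (labels G) (labels ss) (labels-plug C G)
  labels-plug (sibling v cs C) G = ↭-insertʳ (labels G) (labels cs) (labels-plug C G)

  edges-plug : ∀ p C G → edges p (plug C G) ↭ edges (site p C) G ++ edges p (plug C ∅)
  edges-plug p (here ss)        G = ↭-reflexive (edges-⊕ p G ss)
  edges-plug p (child v C ss)   G = ↭-insertˡ (edges (site v C) G) (edges p ss) (edges-plug v C G)
  edges-plug p (sibling v cs C) G = ↭-insertʳ (edges (site p C) G) (edges v cs) (edges-plug p C G)

  labels-plug-branch : ∀ C v cs → labels (plug C (branch v cs ∅)) ↭ (v ∷ labels cs) ++ labels (plug C ∅)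
  labels-plug-branch C v cs with labels-plug C (branch v cs ∅)
  ... | σ rewrite ++-identityʳ (labels cs) = σ

  edges-plug-branch : ∀ p C v cs →
    edges p (plug C (branch v cs ∅)) ↭ (site p C , v) ∷ edges v cs ++ edges p (plug C ∅)
  edges-plug-branch p C v cs with edges-plug p C (branch v cs ∅)
  ... | σ rewrite ++-identityʳ (edges v cs) = σ

  site-∈ : ∀ p C → site p C ∈ p ∷ labels (plug C ∅)
  site-∈ p (here ss)        = here refl
  site-∈ p (child v C ss)   = there (∈-++⁺ˡ {xs = v ∷ labels (plug C ∅)} (site-∈ v C))
  site-∈ p (sibling v cs C) with site-∈ p C
  ... | here q  = here q
  ... | there m = there (there (∈-++⁺ʳ (labels cs) m))

  locate : ∀ p F {y} → y ∈ p ∷ labels F → ∃[ C ] plug C ∅ ≡ F × site p C ≡ y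
  locate p F                (here refl) = here F , refl , refl
  locate p (branch v cs ss) (there m) with ∈-++⁻ (v ∷ labels cs) m
  ... | inj₁ l = let C , q , s = locate v cs l in child v C ss , cong (λ G → branch v G ss) q , s
  ... | inj₂ r = let C , q , s = locate p ss (there r) in sibling v cs C , cong (branch v cs) q , s

  attach : ∀ {p F} x {y} → y ∈ p ∷ labels F →
           ∃[ F′ ] labels F′ ↭ x ∷ labels F × edges p F′ ↭ (y , x) ∷ edges p F
  attach {p} {F} x y∈ with locate p F y∈
  ... | C , refl , refl = plug C (branch x ∅ ∅) , labels-plug C (branch x ∅ ∅) , edges-plug p C (branch x ∅ ∅)

  branch-∉ : ∀ {p v cs} C → Unique (p ∷ labels (plug C (branch v cs ∅))) → v ∉ p ∷ labels (plug C ∅)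
  branch-∉ {v = v} {cs} C u m =
    proj₂ (proj₂ (Unique-∷-split (v ∷ labels cs) (labels-plug-branch C v cs) u)) (here refl , m)

  -- Small branches and their greedy selection.

  -- Only top-level branches are constrained; those below them are smaller still.
  data Small (d : ℕ) : Branches A → Set where
    ∅      : Small d ∅
    branch : ∀ {v cs ss} → suc (size cs) ≤ d → Small d ss → Small d (branch v cs ss)

  -- The children are searched before the vertex itself is tested, so the vertex found is a lowest
  -- one and its own branches are small.
  find-large : ∀ d F → Small d F ⊎
    (∃[ C ] ∃[ v ] ∃[ cs ] F ≡ plug C (branch v cs ∅) × Small d cs × d < suc (size cs))
  find-large d ∅ = inj₁ ∅
  find-large d (branch v cs ss) with find-large d cs
  ... | inj₂ (C , x , xs , refl , rest) = inj₂ (child v C ss , x , xs , refl , rest)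
  ... | inj₁ small with suc (size cs) ≤? d
  ...   | no big = inj₂ (here ss , v , cs , refl , small , ≰⇒> big)
  ...   | yes b≤d with find-large d ss
  ...     | inj₁ small′ = inj₁ (branch b≤d small′)
  ...     | inj₂ (C , x , xs , refl , rest) = inj₂ (sibling v cs C , x , xs , refl , rest)

  -- Greedy: the first branch that no longer fits has at most d vertices.
  select : ∀ d h v {F} → Small d F → h < size F →
    ∃[ G ] ∃[ H ] labels F ↭ labels G ++ labels H × edges v F ↭ edges v G ++ edges v H ×
                  size G ≤ h × h < size G + d
  select d h v {branch x cs ss} (branch b≤d small) h< with suc (size cs) ≤? h
  -- Stopping here leaves `h` places empty, fewer than this branch would need and hence fewer than
  -- `d`.
  ... | no big = ∅ , branch x cs ss , ↭-refl , ↭-refl , z≤n , ≤-trans (≰⇒> big) b≤d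
  ... | yes b≤h =
    let h′ = h ∸ suc (size cs)
        h≡ : suc (size cs) + h′ ≡ h
        h≡ = m+[n∸m]≡n b≤h
        h′< : h′ < size ss
        h′< = +-cancelˡ-< (suc (size cs)) h′ (size ss) (subst (_< suc (size cs) + size ss) (sym h≡)
                (subst (h <_) (cong suc (length-++ (labels cs))) h<))
        G , H , σ , τ , G≤ , <G = select d h′ v small h′<
        eqG : size (branch x cs G) ≡ suc (size cs) + size G
        eqG = cong suc (length-++ (labels cs))
    in branch x cs G , H ,
       ↭-trans (prep x (++⁺ˡ (labels cs) σ)) (↭-reflexive (cong (x ∷_) (sym (++-assoc (labels cs) _ _)))) ,
       ↭-trans (prep _ (++⁺ˡ (edges x cs) τ)) (↭-reflexive (cong (_ ∷_) (sym (++-assoc (edges x cs) _ _)))) ,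
       subst (_≤ h) (sym eqG) (subst (suc (size cs) + size G ≤_) h≡ (+-monoʳ-≤ (suc (size cs)) G≤)) ,
       subst (λ s → h < s + d) (sym eqG)
         (subst (_< suc (size cs) + size G + d) h≡
           (subst (suc (size cs) + h′ <_) (sym (+-assoc (suc (size cs)) (size G) d))
             (+-monoʳ-< (suc (size cs)) <G)))

  -- Peeling off one vertex set.

  -- `X` is the set to invert and `F′` the tree left for later sets. A covered edge loses its lower
  -- end `w`, so sets inside the remaining tree cannot cover it again. The field `keep` ensures that
  -- a parent outside `X` is still there when a cut edge has to be restored.
  record Peel (p : A) (F : Branches A) (X : List A) (F′ : Branches A) : Set where
    field
      inside : ∀ {u} → u ∈ X → u ∈ p ∷ labels F
      shrink : ∀ {u} → u ∈ labels F′ → u ∈ labels F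
      unique : Unique (p ∷ labels F′)
      keep   : ∀ {u} → u ∈ p ∷ labels F → u ∉ X → u ∈ p ∷ labels F′
      edge   : ∀ {u w} → (u , w) ∈ edges p F →
               (u ∈ X × w ∈ X × w ∉ labels F′) ⊎ (¬ (u ∈ X × w ∈ X) × (u , w) ∈ edges p F′)

  open Peel

  peel-nothing : ∀ {p F} → Unique (p ∷ labels F) → Peel p F [] F
  peel-nothing u = record
    { inside = λ ()
    ; shrink = λ m → m
    ; unique = u
    ; keep   = λ m _ → m
    ; edge   = λ m → inj₂ ((λ ()) , m)
    }

  -- Every edge of `G` has both ends in the set, while the lower end of an edge of `H` differs from
  -- `p` and from all labels of `G` by uniqueness.
  peel-branches : ∀ {p F} G H → labels F ↭ labels G ++ labels H → edges p F ↭ edges p G ++ edges p H →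
                  Unique (p ∷ labels F) → Peel p F (p ∷ labels G) H
  peel-branches {p} {F} G H σ τ u = record
    { inside = λ { (here q) → here q ; (there m) → there (∈-resp-↭ (↭-sym σ) (∈-++⁺ˡ m)) }
    ; shrink = shrinkᴴ
    ; unique = proj₁ (proj₂ split)
    ; keep   = λ { (here q) _ → here q
                 ; (there m) u∉ → keepᴴ (∈-++⁻ (labels G) (∈-resp-↭ σ m)) u∉ }
    ; edge   = λ m → edgeᴴ (∈-++⁻ (edges p G) (∈-resp-↭ τ m))
    }
    where
    split = Unique-∷-split (labels G) σ u

    shrinkᴴ : ∀ {u} → u ∈ labels H → u ∈ labels F
    shrinkᴴ m = ∈-resp-↭ (↭-sym σ) (∈-++⁺ʳ (labels G) m)

    keepᴴ : ∀ {u} → u ∈ labels G ⊎ u ∈ labels H → u ∉ p ∷ labels G → u ∈ p ∷ labels H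
    keepᴴ (inj₁ l) u∉ = contradiction (there l) u∉
    keepᴴ (inj₂ r) _  = there r

    edgeᴴ : ∀ {u w} → (u , w) ∈ edges p G ⊎ (u , w) ∈ edges p H →
            (u ∈ p ∷ labels G × w ∈ p ∷ labels G × w ∉ labels H) ⊎
            (¬ (u ∈ p ∷ labels G × w ∈ p ∷ labels G) × (u , w) ∈ edges p H)
    edgeᴴ (inj₁ l) = let u∈ , w∈ = edge-ends p G l
                     in inj₁ (u∈ , there w∈ , λ w∈H → proj₂ (proj₂ split) (w∈ , there w∈H))
    edgeᴴ (inj₂ r) = inj₂ ((λ { (_ , here refl) → Unique-head-∉ u (shrinkᴴ w∈)
                              ; (_ , there w∈G) → proj₂ (proj₂ split) (w∈G , there w∈) }) , r)
      where w∈ = proj₂ (edge-ends p H r)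

  -- `X` stays inside the subtree at `v`, so every edge outside, including the one joining `v` to
  -- its parent, has its upper end outside `X`. As `v` remains the root of what is left of its
  -- subtree, the result is still a tree.
  peel-plug : ∀ {p v cs X H} C → Unique (p ∷ labels (plug C (branch v cs ∅))) → Peel v cs X H →
              Peel p (plug C (branch v cs ∅)) X (plug C (branch v H ∅))
  peel-plug {p} {v} {cs} {X} {H} C u P = record
    { inside = λ m → there (∈-resp-↭ (↭-sym σ) (∈-++⁺ˡ (inside P m)))
    ; shrink = λ m → shrinkᶜ (∈-++⁻ (v ∷ labels H) (∈-resp-↭ (labels-plug-branch C v H) m))
    ; unique = Unique-resp-↭
                 (↭-trans (shift p (v ∷ labels H) _) (prep p (↭-sym (labels-plug-branch C v H))))
                 (Unique-++⁺ (unique P) (proj₁ (proj₂ split)) (λ (l , r) → disj (grow l , r)))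
    ; keep   = λ { (here q) _ → here q
                 ; (there m) u∉ → there (∈-resp-↭ (↭-sym (labels-plug-branch C v H))
                     (keepᶜ (∈-++⁻ (v ∷ labels cs) (∈-resp-↭ σ m)) u∉)) }
    ; edge   = λ m → edgeᶜ (∈-resp-↭ (edges-plug-branch p C v cs) m)
    }
    where
    F₁ = plug C ∅
    σ = labels-plug-branch C v cs
    split = Unique-∷-split (v ∷ labels cs) σ u
    disj : Disjoint (v ∷ labels cs) (p ∷ labels F₁)
    disj = proj₂ (proj₂ split)

    grow : ∀ {u} → u ∈ v ∷ labels H → u ∈ v ∷ labels cs
    grow (here q)  = here q
    grow (there m) = there (shrink P m)

    shrinkᶜ : ∀ {u} → u ∈ v ∷ labels H ⊎ u ∈ labels F₁ → u ∈ labels (plug C (branch v cs ∅))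
    shrinkᶜ (inj₁ l) = ∈-resp-↭ (↭-sym σ) (∈-++⁺ˡ (grow l))
    shrinkᶜ (inj₂ r) = ∈-resp-↭ (↭-sym σ) (∈-++⁺ʳ (v ∷ labels cs) r)

    keepᶜ : ∀ {u} → u ∈ v ∷ labels cs ⊎ u ∈ labels F₁ → u ∉ X → u ∈ (v ∷ labels H) ++ labels F₁
    keepᶜ (inj₁ l) u∉ = ∈-++⁺ˡ (keep P l u∉)
    keepᶜ (inj₂ r) _  = ∈-++⁺ʳ (v ∷ labels H) r

    τ = edges-plug-branch p C v H

    edgeᶜ : ∀ {u w} → (u , w) ∈ (site p C , v) ∷ edges v cs ++ edges p F₁ →
            (u ∈ X × w ∈ X × w ∉ labels (plug C (branch v H ∅))) ⊎
            (¬ (u ∈ X × w ∈ X) × (u , w) ∈ edges p (plug C (branch v H ∅)))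
    edgeᶜ (here refl) =
      inj₂ ((λ (y∈X , _) → disj (inside P y∈X , site-∈ p C)) , ∈-resp-↭ (↭-sym τ) (here refl))
    edgeᶜ {u} {w} (there m) with ∈-++⁻ (edges v cs) m
    ... | inj₂ r = inj₂ ((λ (u∈X , _) → disj (inside P u∈X , proj₁ (edge-ends p F₁ r))) ,
                         ∈-resp-↭ (↭-sym τ) (there (∈-++⁺ʳ (edges v H) r)))
    ... | inj₁ l with edge P l
    ...   | inj₂ (¬X , l′) = inj₂ (¬X , ∈-resp-↭ (↭-sym τ) (there (∈-++⁺ˡ l′)))
    ...   | inj₁ (u∈X , w∈X , w∉H) = inj₁ (u∈X , w∈X , λ w∈ →
      gone (∈-++⁻ (v ∷ labels H) (∈-resp-↭ (labels-plug-branch C v H) w∈)))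
      where
      w∈cs = proj₂ (edge-ends v cs l)
      gone : ¬ (w ∈ v ∷ labels H ⊎ w ∈ labels F₁)
      gone (inj₁ (here refl)) = Unique-head-∉ (proj₁ split) w∈cs
      gone (inj₁ (there w∈H)) = w∉H w∈H
      gone (inj₂ r)           = disj (there w∈cs , there r)

  -- X was found after deleting the subtree at v together with the edge to its
  -- parent. That edge returns as a pendant edge of F′, unless the parent lies in
  -- X, in which case it is covered.
  peel-subtree-into : ∀ {p v cs X F₁ F′} C → Unique (p ∷ labels (plug C (branch v cs ∅))) →
    Peel p (plug C ∅) X F₁ → Unique (p ∷ labels F′) →
    (∀ {u} → u ∈ labels F′ → u ≡ v ⊎ u ∈ labels F₁) →
    (∀ {u} → u ∈ labels F₁ → u ∈ labels F′) →
    (∀ {e} → e ∈ edges p F₁ → e ∈ edges p F′) →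
    (site p C ∈ X × v ∉ labels F′) ⊎ (site p C ∉ X × (site p C , v) ∈ edges p F′) →
    Peel p (plug C (branch v cs ∅)) ((v ∷ labels cs) ++ X) F′
  peel-subtree-into {p} {v} {cs} {X} {F₁} {F′} C u P u′ new old oldE link = record
    { inside = insideˢ
    ; shrink = λ m → shrinkˢ (new m)
    ; unique = u′
    ; keep   = keepˢ
    ; edge   = λ m → edgeˢ (∈-resp-↭ (edges-plug-branch p C v cs) m)
    }
    where
    F = plug C (branch v cs ∅)
    T = v ∷ labels cs
    Y = T ++ X
    σ = labels-plug-branch C v cs
    split = Unique-∷-split T σ u
    disj : Disjoint T (p ∷ labels (plug C ∅))
    disj = proj₂ (proj₂ split)

    grow : ∀ {u} → u ∈ p ∷ labels (plug C ∅) → u ∈ p ∷ labels F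
    grow (here q)  = here q
    grow (there m) = there (∈-resp-↭ (↭-sym σ) (∈-++⁺ʳ T m))

    insideˢ : ∀ {u} → u ∈ Y → u ∈ p ∷ labels F
    insideˢ m with ∈-++⁻ T m
    ... | inj₁ l = there (∈-resp-↭ (↭-sym σ) (∈-++⁺ˡ l))
    ... | inj₂ r = grow (inside P r)

    shrinkˢ : ∀ {u} → u ≡ v ⊎ u ∈ labels F₁ → u ∈ labels F
    shrinkˢ (inj₁ refl) = ∈-resp-↭ (↭-sym σ) (here refl)
    shrinkˢ (inj₂ m)    = ∈-resp-↭ (↭-sym σ) (∈-++⁺ʳ T (shrink P m))

    widen : ∀ {u} → u ∈ p ∷ labels F₁ → u ∈ p ∷ labels F′
    widen (here q)  = here q
    widen (there m) = there (old m)

    keepˢ : ∀ {u} → u ∈ p ∷ labels F → u ∉ Y → u ∈ p ∷ labels F′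
    keepˢ (here q)  _  = here q
    keepˢ (there m) u∉ with ∈-++⁻ T (∈-resp-↭ σ m)
    ... | inj₁ l = contradiction (∈-++⁺ˡ l) u∉
    ... | inj₂ r = widen (keep P (there r) (λ u∈X → u∉ (∈-++⁺ʳ T u∈X)))

    fromX : ∀ {u} → u ∈ p ∷ labels (plug C ∅) → u ∈ Y → u ∈ X
    fromX m u∈Y with ∈-++⁻ T u∈Y
    ... | inj₁ l = contradiction (l , m) disj
    ... | inj₂ r = r

    edgeˢ : ∀ {u w} → (u , w) ∈ (site p C , v) ∷ edges v cs ++ edges p (plug C ∅) →
            (u ∈ Y × w ∈ Y × w ∉ labels F′) ⊎ (¬ (u ∈ Y × w ∈ Y) × (u , w) ∈ edges p F′)
    edgeˢ (here refl) = Sum.map (λ (y∈X , v∉) → ∈-++⁺ʳ T y∈X , here refl , v∉)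
                                (λ (y∉X , e) → (λ (y∈Y , _) → y∉X (fromX (site-∈ p C) y∈Y)) , e) link
    edgeˢ {u} {w} (there m) with ∈-++⁻ (edges v cs) m
    -- The lower end is a proper descendant of `v`, and `v` alone can return from the deleted
    -- subtree.
    ... | inj₁ l = inj₁ (∈-++⁺ˡ (proj₁ ends) , ∈-++⁺ˡ (there (proj₂ ends)) , λ w∈ → gone (new w∈))
      where
      ends = edge-ends v cs l
      gone : ¬ (w ≡ v ⊎ w ∈ labels F₁)
      gone (inj₁ refl) = Unique-head-∉ (proj₁ split) (proj₂ ends)
      gone (inj₂ w∈)   = disj (there (proj₂ ends) , there (shrink P w∈))
    ... | inj₂ r with edge-ends p (plug C ∅) r | edge P r
    ...   | u∈ , w∈ | inj₂ (¬X , e) =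
      inj₂ ((λ (u∈Y , w∈Y) → ¬X (fromX u∈ u∈Y , fromX (there w∈) w∈Y)) , oldE e)
    ...   | u∈ , w∈ | inj₁ (u∈X , w∈X , w∉) = inj₁ (∈-++⁺ʳ T u∈X , ∈-++⁺ʳ T w∈X , λ w∈′ → gone (new w∈′))
      where
      gone : ¬ (w ≡ v ⊎ w ∈ labels F₁)
      gone (inj₁ refl) = disj (here refl , there w∈)
      gone (inj₂ w∈₁)  = w∉ w∈₁

-- The key claim.

module _ {A : Set} (_≟_ : DecidableEquality A) where

  open DecMembership _≟_ using (_∈?_)
  open Peel

  -- The extra unit in the size bound is the leaf `v` reattached to its parent. It is the single
  -- edge lost by taking a whole subtree into the set.
  peel-subtree : ∀ {p v cs X F₁} C → Unique (p ∷ labels (plug C (branch v cs ∅))) →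
    Peel p (plug C ∅) X F₁ →
    ∃[ F′ ] Peel p (plug C (branch v cs ∅)) ((v ∷ labels cs) ++ X) F′ × size F′ ≤ suc (size F₁)
  peel-subtree {p} {v} {cs} {X} {F₁} C u P with site p C ∈? X
  ... | yes y∈X =
    F₁ , peel-subtree-into C u P (unique P) inj₂ (λ m → m) (λ m → m)
           (inj₁ (y∈X , λ m → branch-∉ C u (there (shrink P m)))) ,
    n≤1+n _
  ... | no y∉X with attach v (keep P (site-∈ p C) y∉X)
  ...   | F′ , σ , τ =
    F′ , peel-subtree-into C u P unique′ new (λ m → ∈-resp-↭ (↭-sym σ) (there m))
           (λ m → ∈-resp-↭ (↭-sym τ) (there m)) (inj₂ (y∉X , ∈-resp-↭ (↭-sym τ) (here refl))) ,
    ≤-reflexive (↭-length σ)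
    where
    unique′ : Unique (p ∷ labels F′)
    unique′ = Unique-resp-↭ (↭-trans (shift p (v ∷ []) (labels F₁)) (prep p (↭-sym σ)))
      (Unique-∷⁺ (λ { (here q) → branch-∉ C u (here q) ; (there m) → branch-∉ C u (there (shrink P m)) }) (unique P))

    new : ∀ {u} → u ∈ labels F′ → u ≡ v ⊎ u ∈ labels F₁
    new m with ∈-resp-↭ σ m
    ... | here q   = inj₁ q
    ... | there m′ = inj₂ m′

  -- Since `size` counts edges, the last inequality says that at least g - d edges disappear. The
  -- induction is on `d`, the permitted loss.
  peel : ∀ d g (p : A) F → Unique (p ∷ labels F) → g ≤ size F → 2 * g < suc d * suc d →
         ∃[ X ] ∃[ F′ ] Peel p F X F′ × length X ≤ g × size F′ + g ≤ size F + d
  peel d g p F u g≤ 2g< with g ≤? d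
  -- No edge has to be removed.
  ... | yes g≤d = [] , F , peel-nothing u , z≤n , +-monoʳ-≤ (size F) g≤d
  peel d       zero    p F u g≤ 2g<      | no g≰d = contradiction z≤n g≰d
  peel zero    (suc h) p F u g≤ (s≤s ()) | no _
  peel (suc d) (suc h) p F u g≤ 2g< | no _ with find-large (suc d) F
  ... | inj₁ small =
    -- The root takes one of the `suc h` places and leaves `h` for the branches.
    let G , H , σ , τ , G≤ , <G = select (suc d) h p small g≤
        size≡ = trans (↭-length σ) (length-++ (labels G))
    in p ∷ labels G , H , peel-branches G H σ τ u , s≤s G≤ , (begin
         size H + suc h                ≤⟨ +-monoʳ-≤ (size H) <G ⟩
         size H + (size G + suc d)     ≡⟨ regroup (size H) (size G) (suc d) ⟩
         size G + size H + suc d       ≡⟨ cong (_+ suc d) size≡ ⟨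
         size F + suc d                ∎)
    where
    open ≤-Reasoning
    regroup : ∀ a b c → a + (b + c) ≡ b + a + c
    regroup = solve-∀
  ... | inj₂ (C , v , cs , refl , small , d<) with suc (size cs) ≤? suc h
  ...   | no g<b =
    -- With `v` the subtree has more than `suc h` vertices, so its branches alone have more than
    -- `h`.
    let G , H , σ , τ , G≤ , <G = select (suc d) h v small (s≤s⁻¹ (≰⇒> g<b))
        u-cs = proj₁ (Unique-∷-split (v ∷ labels cs) (labels-plug-branch C v cs) u)
        size≡ = trans (↭-length σ) (length-++ (labels G))
        plug≡ : ∀ S → size (plug C (branch v S ∅)) ≡ suc (size S) + size (plug C ∅)
        plug≡ S = trans (↭-length (labels-plug-branch C v S)) (length-++ (v ∷ labels S))
    in v ∷ labels G , plug C (branch v H ∅) , peel-plug C u (peel-branches G H σ τ u-cs) , s≤s G≤ , (begin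
         size (plug C (branch v H ∅)) + suc h               ≡⟨ cong (_+ suc h) (plug≡ H) ⟩
         suc (size H) + size (plug C ∅) + suc h             ≤⟨ +-monoʳ-≤ (suc (size H) + size (plug C ∅)) <G ⟩
         suc (size H) + size (plug C ∅) + (size G + suc d)  ≡⟨ regroup (size H) (size (plug C ∅)) (size G) (suc d) ⟩
         suc (size G + size H) + size (plug C ∅) + suc d    ≡⟨ cong (λ s → suc s + size (plug C ∅) + suc d) size≡ ⟨
         suc (size cs) + size (plug C ∅) + suc d            ≡⟨ cong (_+ suc d) (plug≡ cs) ⟨
         size (plug C (branch v cs ∅)) + suc d              ∎)
    where
    open ≤-Reasoning
    regroup : ∀ a b c e → suc a + b + (c + e) ≡ suc (c + a) + b + e
    regroup = solve-∀
  ...   | yes b≤g =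
    -- The subtree fills `b` places, and the other `g′` are filled from the rest of the tree. One
    -- unit of permitted loss is reserved for the edge above `v`.
    let X , F₁ , P , X≤ , F₁≤ = peel d g′ p (plug C ∅) u₁ g′≤ 2g′<
        F′ , P′ , F′≤ = peel-subtree C u P
    in (v ∷ labels cs) ++ X , F′ , P′ ,
       (begin
         length ((v ∷ labels cs) ++ X)  ≡⟨ length-++ (v ∷ labels cs) ⟩
         b + length X                   ≤⟨ +-monoʳ-≤ b X≤ ⟩
         b + g′                         ≡⟨ g≡ ⟩
         suc h                          ∎) ,
       (begin
         size F′ + suc h                ≤⟨ +-monoˡ-≤ (suc h) F′≤ ⟩
         suc (size F₁) + suc h          ≡⟨ cong (suc (size F₁) +_) g≡ ⟨
         suc (size F₁) + (b + g′)       ≡⟨ regroup (size F₁) b g′ ⟩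
         suc b + (size F₁ + g′)         ≤⟨ +-monoʳ-≤ (suc b) F₁≤ ⟩
         suc b + (size (plug C ∅) + d)  ≡⟨ regroup′ b (size (plug C ∅)) d ⟩
         b + size (plug C ∅) + suc d    ≡⟨ cong (_+ suc d) size≡ ⟨
         size F + suc d                 ∎)
    where
    open ≤-Reasoning
    b  = suc (size cs)
    g′ = suc h ∸ b
    g≡ : b + g′ ≡ suc h
    g≡ = m+[n∸m]≡n b≤g

    u₁ : Unique (p ∷ labels (plug C ∅))
    u₁ = proj₁ (proj₂ (Unique-∷-split (v ∷ labels cs) (labels-plug-branch C v cs) u))

    size≡ : size (plug C (branch v cs ∅)) ≡ b + size (plug C ∅)
    size≡ = trans (↭-length (labels-plug-branch C v cs)) (length-++ (v ∷ labels cs))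

    g′≤ : g′ ≤ size (plug C ∅)
    g′≤ = +-cancelˡ-≤ b g′ (size (plug C ∅)) (begin
      b + g′             ≡⟨ g≡ ⟩
      suc h              ≤⟨ g≤ ⟩
      size F             ≡⟨ size≡ ⟩
      b + size (plug C ∅) ∎)

    regroup : ∀ a b c → suc a + (b + c) ≡ suc b + (a + c)
    regroup = solve-∀
    regroup′ : ∀ a b c → suc a + (b + c) ≡ a + b + suc c
    regroup′ = solve-∀
    square : ∀ d → 2 * suc (suc d) + suc d * suc d ≡ suc (suc (suc d) * suc (suc d))
    square = solve-∀
    double : ∀ a c → 2 * a + 2 * c ≡ 2 * (a + c)
    double = solve-∀

    -- 2(g − b) < (d+2)² − 2(d+2) < (d+1)², as b ≥ d + 2.
    2g′< : 2 * g′ < suc d * suc d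
    2g′< = +-cancelˡ-< (2 * suc (suc d)) (2 * g′) (suc d * suc d) (begin-strict
      2 * suc (suc d) + 2 * g′          ≤⟨ +-monoˡ-≤ (2 * g′) (*-monoʳ-≤ 2 d<) ⟩
      2 * b + 2 * g′                    ≡⟨ double b g′ ⟩
      2 * (b + g′)                      ≡⟨ cong (2 *_) g≡ ⟩
      2 * suc h                         <⟨ 2g< ⟩
      suc (suc d) * suc (suc d)         <⟨ n<1+n _ ⟩
      suc (suc (suc d) * suc (suc d))   ≡⟨ square d ⟨
      2 * suc (suc d) + suc d * suc d   ∎)

  -- Parity of coverings and iteration of the key claim.

  -- Two inversions of the same pair cancel, so only the parity of the number of sets covering it is
  -- recorded.
  flips : List (List A) → A → A → Bool
  flips []       u w = false
  flips (X ∷ Xs) u w = (does (u ∈? X) ∧ does (w ∈? X)) xor flips Xs u w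

  flips-∉ : ∀ {u w} Xs → All (w ∉_) Xs → flips Xs u w ≡ false
  flips-∉ [] [] = refl
  flips-∉ {u} {w} (X ∷ Xs) (w∉ ∷ ws) rewrite dec-false (w ∈? X) w∉ | flips-∉ {u} Xs ws with does (u ∈? X)
  ... | true  = refl
  ... | false = refl

  flips-both : ∀ {u w X} Xs → u ∈ X → w ∈ X → All (w ∉_) Xs → flips (X ∷ Xs) u w ≡ true
  flips-both {u} {w} {X} Xs u∈ w∈ ws
    rewrite dec-true (u ∈? X) u∈ | dec-true (w ∈? X) w∈ | flips-∉ {u} Xs ws = refl

  flips-¬both : ∀ {u w X} Xs → ¬ (u ∈ X × w ∈ X) → flips (X ∷ Xs) u w ≡ flips Xs u w
  flips-¬both {u} {w} {X} Xs ¬X with u ∈? X | w ∈? X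
  ... | no _  | _     = refl
  ... | yes _ | no _  = refl
  ... | yes a | yes b = contradiction (a , b) ¬X

  -- The numerical hypothesis reads size F ≤ k(g - d), and each peeling pays for one summand g - d.
  -- Confining all sets to the current tree is what the induction needs to keep later sets away from
  -- edges already covered.
  decompose : ∀ d g → 2 * g < suc d * suc d → ∀ k (p : A) F → Unique (p ∷ labels F) → size F + k * d ≤ k * g →
    ∃[ Xs ] length Xs ≤ k × All (λ X → length X ≤ g) Xs ×
            All (All (_∈ p ∷ labels F)) Xs ×
            (∀ {u w} → (u , w) ∈ edges p F → flips Xs u w ≡ true)
  decompose d g 2g< zero p ∅ u bound = [] , z≤n , [] , [] , λ ()
  decompose d g 2g< (suc k) p F u bound with size F <? g
  -- Fewer than `g` edges means at most `g` vertices, so one set takes the whole tree.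
  ... | yes F<g = (p ∷ labels F) ∷ [] , s≤s z≤n , F<g ∷ [] , All.tabulate (λ m → m) ∷ [] ,
    λ m → let u∈ , w∈ = edge-ends p F m in flips-both [] u∈ (there w∈) []
  ... | no F≮g =
    let X , F′ , P , X≤ , F′≤ = peel d g p F u (≮⇒≥ F≮g) 2g<
        Xs , len , sizes , ins , odd = decompose d g 2g< k p F′ (unique P) (rest F′≤)
    in X ∷ Xs , s≤s len , X≤ ∷ sizes , All.tabulate (inside P) ∷ All.map (All.map (widen P)) ins , odd′ P Xs ins odd
    where
    open ≤-Reasoning
    rest : ∀ {s} → s + g ≤ size F + d → s + k * d ≤ k * g
    rest {s} le = +-cancelˡ-≤ g (s + k * d) (k * g) (begin
      g + (s + k * d)        ≡⟨ +-assoc g s (k * d) ⟨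
      g + s + k * d          ≡⟨ cong (_+ k * d) (+-comm g s) ⟩
      s + g + k * d          ≤⟨ +-monoˡ-≤ (k * d) le ⟩
      size F + d + k * d     ≡⟨ +-assoc (size F) d (k * d) ⟩
      size F + (d + k * d)   ≤⟨ bound ⟩
      g + k * g              ∎)
    widen : ∀ {X F′ u} → Peel p F X F′ → u ∈ p ∷ labels F′ → u ∈ p ∷ labels F
    widen P (here q)  = here q
    widen P (there m) = there (shrink P m)
    odd′ : ∀ {X F′} → Peel p F X F′ → ∀ Xs → All (All (_∈ p ∷ labels F′)) Xs →
           (∀ {u w} → (u , w) ∈ edges p F′ → flips Xs u w ≡ true) →
           ∀ {u w} → (u , w) ∈ edges p F → flips (X ∷ Xs) u w ≡ true
    odd′ {X} {F′} P Xs ins odd {u₀} {w} m with edge P m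
    ... | inj₂ (¬X , m′) = trans (flips-¬both Xs ¬X) (odd m′)
    -- The edge is covered by `X` and by no later set, since `w` has left the remaining tree.
    ... | inj₁ (u∈ , w∈ , w∉) = flips-both Xs u∈ w∈ (All.map (λ f w∈X → gone (All.lookup f w∈X)) ins)
      where
      gone : w ∉ p ∷ labels F′
      gone (here refl) = Unique-head-∉ u (proj₂ (edge-ends p F m))
      gone (there w∈′) = w∉ w∈′

-- Completing a forest to a rooted spanning tree.

lookup-injective : ∀ {B : Set} {xs : List B} → Unique xs → Injective _≡_ _≡_ (lookup xs)
lookup-injective (x∉ ∷ u) {zero}  {zero}  _ = refl
lookup-injective {xs = _ ∷ xs} (x∉ ∷ u) {zero}  {suc j} q = contradiction q (All.lookup x∉ (∈-lookup {xs = xs} j))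
lookup-injective {xs = _ ∷ xs} (x∉ ∷ u) {suc i} {zero}  q = contradiction (sym q) (All.lookup x∉ (∈-lookup {xs = xs} i))
lookup-injective (x∉ ∷ u) {suc i} {suc j} q = cong suc (lookup-injective u q)

Unique-length : ∀ {n} {xs : List (Fin n)} → Unique xs → length xs ≤ n
Unique-length u = injective⇒≤ (lookup-injective u)

module _ {n : ℕ} (G : Graph n) where

  _~_ : Fin n → Fin n → Set
  u ~ v = Adj G u v ≡ true

  ~-sym : ∀ {u v} → u ~ v → v ~ u
  ~-sym {u} {v} = trans (Graph.sym G v u)

  ~-irrefl : ∀ {u} → ¬ u ~ u
  ~-irrefl {u} q with () ← trans (sym q) (irrefl G u)

  _~?_ : ∀ u v → Dec (u ~ v)
  u ~? v = Adj G u v Bool.≟ true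

  -- A path as an injective function, the form required by `Cycle`. Confining it to `l` keeps it
  -- injective when a vertex outside `l` is prepended.
  record Segment (x z : Fin n) (l : List (Fin n)) (k : ℕ) : Set where
    field
      at    : Fin (suc k) → Fin n
      start : at zero ≡ x
      end   : at (fromℕ k) ≡ z
      inj   : Injective _≡_ _≡_ at
      step  : ∀ (i : Fin k) → at (inject₁ i) ~ at (suc i)
      inner : ∀ i → at i ∈ l

  open Segment

  extend : ∀ {x w z l k} → x ~ w → x ∉ l → Segment w z l k → Segment x z (x ∷ l) (suc k)
  extend {x} {w} {z} {l} {k} x~w x∉ s = record
    { at = at′ ; start = refl ; end = end s ; inj = inj′ ; step = step′ ; inner = inner′ }
    where
    at′ : Fin (suc (suc k)) → Fin n
    at′ zero    = x
    at′ (suc i) = at s i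

    inj′ : Injective _≡_ _≡_ at′
    inj′ {zero}  {zero}  _ = refl
    inj′ {zero}  {suc j} q = contradiction (subst (_∈ l) (sym q) (inner s j)) x∉
    inj′ {suc i} {zero}  q = contradiction (subst (_∈ l) q (inner s i)) x∉
    inj′ {suc i} {suc j} q = cong suc (inj s q)

    step′ : ∀ i → at′ (inject₁ i) ~ at′ (suc i)
    step′ zero    = subst (x ~_) (sym (start s)) x~w
    step′ (suc i) = step s i

    inner′ : ∀ i → at′ i ∈ x ∷ l
    inner′ zero    = here refl
    inner′ (suc i) = there (inner s i)

  segment : ∀ {x l z} → Linked _~_ (x ∷ l) → Unique (x ∷ l) → z ∈ x ∷ l → ∃[ k ] Segment x z (x ∷ l) k
  segment {x} path u (here refl) = 0 , record
    { at = λ _ → x ; start = refl ; end = refl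
    ; inj = λ { {zero} {zero} _ → refl } ; step = λ () ; inner = λ _ → here refl }
  segment (x~w ∷ path) (x∉ ∷ u) (there z∈) with segment path u z∈
  ... | k , s = suc k , extend x~w (Unique-head-∉ (x∉ ∷ u)) s

  -- The endpoint `z` comes after both `x` and `w`, so prepending these two to the segment ending at
  -- `z` gives the three or more vertices of a cycle.
  chord⇒cycle : ∀ {x w l z} → Linked _~_ (x ∷ w ∷ l) → Unique (x ∷ w ∷ l) → z ∈ l → x ~ z → Cycle G
  chord⇒cycle {l = t ∷ l} (x~w ∷ w~t ∷ path) (x∉ ∷ w∉ ∷ u) z∈ x~z with segment path u z∈
  ... | k , s = record
    { m = k ; f = at c ; inj = inj c ; step = step c
    ; close = trans (cong (λ y → Adj G y _) (end c)) (~-sym x~z) }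
    where c = extend x~w (Unique-head-∉ (x∉ ∷ w∉ ∷ u)) (extend w~t (Unique-head-∉ (w∉ ∷ u)) s)

  -- Degree at least two in the subgraph induced by `S`.
  Branching : List (Fin n) → Fin n → Set
  Branching S x = Any (λ y → Any (λ z → y ≢ z × x ~ y × x ~ z) S) S

  branching? : ∀ S x → Dec (Branching S x)
  branching? S x = any? (λ y → any? (λ z → ¬? (y Fin.≟ z) ×-dec ((x ~? y) ×-dec (x ~? z))) S) S

  avoid : ∀ {S x} w → Branching S x → ∃[ z ] z ∈ S × z ≢ w × x ~ z
  avoid w b with find b
  ... | y , y∈ , b′ with find b′
  ... | z , z∈ , y≢z , x~y , x~z with y Fin.≟ w
  ...   | no y≢w   = y , y∈ , y≢w , x~y
  ...   | yes refl = z , z∈ , (λ q → y≢z (sym q)) , x~z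

  module _ (acyclic : IsForest G) where

    -- A path whose head always has a second neighbour either closes a cycle or
    -- can be prolonged beyond n vertices.
    no-prolongation : ∀ {S} → All (Branching S) S → ∀ fuel {x w l} → x ∈ S →
      Linked _~_ (x ∷ w ∷ l) → Unique (x ∷ w ∷ l) → n < fuel + length (x ∷ w ∷ l) → ⊥
    -- The path now has more than `n` distinct vertices.
    no-prolongation br zero x∈ path u n< = <⇒≱ n< (Unique-length u)
    no-prolongation br (suc fuel) {x} {w} {l} x∈ path u n< with avoid w (All.lookup br x∈)
    ... | z , z∈ , z≢w , x~z with z ∈? l
      where open DecMembership (Fin._≟_ {n}) using (_∈?_)
    ...   | yes z∈l = acyclic (chord⇒cycle path u z∈l x~z)
    ...   | no z∉l  = no-prolongation br fuel z∈ (~-sym x~z ∷ path)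
      (Unique-∷⁺ (λ { (here refl) → ~-irrefl x~z ; (there (here q)) → z≢w q ; (there (there m)) → z∉l m }) u)
      (subst (n <_) (sym (+-suc fuel _)) n<)

    -- If all vertices were branching, an edge at `x₀` would start a path that can be prolonged
    -- without end. Isolated vertices count as leaves, as the forest may be disconnected.
    leaf : ∀ x₀ S₀ → let S = x₀ ∷ S₀ in
           ∃[ x ] x ∈ S × (∀ {y z} → y ∈ S → z ∈ S → x ~ y → x ~ z → y ≡ z)
    leaf x₀ S₀ with all? (branching? (x₀ ∷ S₀)) (x₀ ∷ S₀)
    ... | no ¬br with find (¬All⇒Any¬ (branching? (x₀ ∷ S₀)) _ ¬br)
    ...   | x , x∈ , ¬b = x , x∈ , λ {y} {z} y∈ z∈ x~y x~z →
      decidable-stable (y Fin.≟ z) (λ y≢z → ¬b (lose y∈ (lose z∈ (y≢z , x~y , x~z))))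
    leaf x₀ S₀ | yes br with avoid x₀ (All.lookup br (here refl))
    ... | z , z∈ , z≢x₀ , x₀~z = contradiction (subst (n <_) (+-comm 2 n) (n≤1+n _))
      (no-prolongation br n z∈ (~-sym x₀~z ∷ [-]) (Unique-∷⁺ (λ { (here q) → z≢x₀ q }) ([] ∷ [])))

    -- A leaf is removed, the rest is treated by induction, and the leaf is hung back on. The tree
    -- may contain edges that are absent from `G`; these connect the components.
    spanning-tree : ∀ s S → length S ≡ suc s → Unique S →
      ∃[ r ] ∃[ F ] r ∷ labels F ↭ S ×
        (∀ {u v} → u ∈ S → v ∈ S → u ~ v → (u , v) ∈ edges r F ⊎ (v , u) ∈ edges r F)
    spanning-tree zero (x ∷ []) _ _ = x , ∅ , ↭-refl ,
      λ { (here refl) (here refl) u~v → contradiction u~v ~-irrefl }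
    spanning-tree (suc s) S@(x₀ ∷ S₀) len u with leaf x₀ S₀
    ... | x , x∈ , one with ∈-∃++ x∈
    ... | as , bs , S≡ = result
      where
      S′ = as ++ bs
      σ : S ↭ x ∷ S′
      σ = ↭-trans (↭-reflexive S≡) (shift x as bs)

      Sub = spanning-tree s S′ (suc-injective (trans (sym (↭-length σ)) len))
              (proj₁ (proj₂ (Unique-++⁻ (x ∷ []) (Unique-resp-↭ σ u))))
      r = proj₁ Sub
      F = proj₁ (proj₂ Sub)
      τ = proj₁ (proj₂ (proj₂ Sub))
      old = proj₂ (proj₂ (proj₂ Sub))

      in-S : ∀ {v} → v ∈ S′ → v ∈ S
      in-S m = ∈-resp-↭ (↭-sym σ) (there m)

      hang : ∀ {y} → y ∈ r ∷ labels F → (∀ {v} → v ∈ S′ → x ~ v → y ≡ v) →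
        ∃[ r′ ] ∃[ F′ ] r′ ∷ labels F′ ↭ S ×
          (∀ {u v} → u ∈ S → v ∈ S → u ~ v → (u , v) ∈ edges r′ F′ ⊎ (v , u) ∈ edges r′ F′)
      hang {y} y∈ nbr with attach x y∈
      ... | F′ , ρ , ε = r , F′ ,
        ↭-trans (↭-trans (prep r ρ) (↭-sym (shift r (x ∷ []) (labels F)))) (↭-trans (prep x τ) (↭-sym σ)) ,
        λ u∈ v∈ → new (∈-resp-↭ σ u∈) (∈-resp-↭ σ v∈)
        where
        new : ∀ {u v} → u ∈ x ∷ S′ → v ∈ x ∷ S′ → u ~ v → (u , v) ∈ edges r F′ ⊎ (v , u) ∈ edges r F′
        new (here refl) (here refl) u~v = contradiction u~v ~-irrefl
        new (here refl) (there v∈)  u~v with refl ← nbr v∈ u~v = inj₂ (∈-resp-↭ (↭-sym ε) (here refl))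
        new (there u∈)  (here refl) u~v with refl ← nbr u∈ (~-sym u~v) = inj₁ (∈-resp-↭ (↭-sym ε) (here refl))
        new (there u∈)  (there v∈)  u~v =
          Sum.map (λ m → ∈-resp-↭ (↭-sym ε) (there m)) (λ m → ∈-resp-↭ (↭-sym ε) (there m)) (old u∈ v∈ u~v)

      result : ∃[ r′ ] ∃[ F′ ] r′ ∷ labels F′ ↭ S ×
          (∀ {u v} → u ∈ S → v ∈ S → u ~ v → (u , v) ∈ edges r′ F′ ⊎ (v , u) ∈ edges r′ F′)
      result with any? (x ~?_) S′
      -- A leaf without neighbours may hang anywhere; the root is chosen.
      ... | no none = hang (here refl) (λ v∈ x~v → contradiction (lose v∈ x~v) none)
      ... | yes some with find some
      ...   | y , y∈ , x~y = hang (∈-resp-↭ (↭-sym τ) y∈) (λ v∈ x~v → one (in-S y∈) (in-S v∈) x~y x~v)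

-- From lists of vertices to inversions.

module _ {n : ℕ} where

  open DecMembership (Fin._≟_ {n}) using (_∈?_)

  toVSet : List (Fin n) → VSet n
  toVSet []       = Vec.replicate n false
  toVSet (x ∷ xs) = toVSet xs [ x ]≔ true

  lookup-toVSet : ∀ X u → Vec.lookup (toVSet X) u ≡ does (u ∈? X)
  lookup-toVSet [] u = lookup-replicate u false
  lookup-toVSet (x ∷ X) u with u Fin.≟ x
  ... | yes refl = lookup∘update u (toVSet X) true
  ... | no u≢x   = trans (lookup∘update′ u≢x (toVSet X) true) (lookup-toVSet X u)

size-replicate : ∀ n → Defs.size (Vec.replicate n false) ≡ 0
size-replicate zero    = refl
size-replicate (suc n) = size-replicate n

size-update : ∀ {n} (X : VSet n) x → Defs.size (X [ x ]≔ true) ≤ suc (Defs.size X)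
size-update (false Vec.∷ X) zero    = ≤-refl
size-update (true  Vec.∷ X) zero    = n≤1+n _
size-update (false Vec.∷ X) (suc x) = size-update X x
size-update (true  Vec.∷ X) (suc x) = s≤s (size-update X x)

-- An inequality, because a repeated vertex is counted once in the set.
size-toVSet : ∀ {n} (X : List (Fin n)) → Defs.size (toVSet X) ≤ length X
size-toVSet {n} []  = ≤-reflexive (size-replicate n)
size-toVSet (x ∷ X) = ≤-trans (size-update (toVSet X) x) (s≤s (size-toVSet X))

flips-comm : ∀ {n} Xs (u v : Fin n) → flips Fin._≟_ Xs u v ≡ flips Fin._≟_ Xs v u
flips-comm []       u v = refl
flips-comm (X ∷ Xs) u v = cong₂ _xor_ (Bool.∧-comm (does (u ∈? X)) (does (v ∈? X))) (flips-comm Xs u v)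
  where open DecMembership Fin._≟_ using (_∈?_)

-- An inversion covering both vertices swaps the values at `(u , v)` and `(v , u)`; any other leaves
-- both unchanged. Two swaps restore them.
foldl-invert : ∀ {n} (A : ArcRel n) Xs u v →
  foldl invert A (map toVSet Xs) u v ≡ (if flips Fin._≟_ Xs u v then A v u else A u v)
foldl-invert A [] u v = refl
foldl-invert A (X ∷ Xs) u v
  rewrite foldl-invert (invert A (toVSet X)) Xs u v | lookup-toVSet X u | lookup-toVSet X v
  with does (u ∈? X) | does (v ∈? X) | flips Fin._≟_ Xs u v
  where open DecMembership Fin._≟_ using (_∈?_)
... | true  | true  | true  = refl
... | true  | true  | false = refl
... | true  | false | true  = refl
... | true  | false | false = refl
... | false | true  | true  = refl
... | false | true  | false = refl
... | false | false | true  = refl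
... | false | false | false = refl

-- Arithmetic of the bound and conclusion.

integer-sqrt : ∀ m → ∃[ d ] d * d ≤ m × m < suc d * suc d
integer-sqrt zero = 0 , z≤n , s≤s z≤n
integer-sqrt (suc m) with integer-sqrt m
... | d , d²≤ , m< with suc m <? suc d * suc d
...   | yes m<′ = d , m≤n⇒m≤1+n d²≤ , m<′
...   | no ≥    = suc d , ≮⇒≥ ≥ , ≤-<-trans m< (*-mono-< (n<1+n (suc d)) (n<1+n (suc d)))

-- Compare squares: the second clause gives a² ≥ 2k²p ≥ (kd)² for a = kp - (n - 1), hence kd ≤ a.
CeilBound⇒budget : ∀ p n k d → d * d ≤ 2 * p → CeilBound p n k → n ∸ 1 + k * d ≤ k * p
CeilBound⇒budget p n k d d²≤ (n≤ , sq , _) = begin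
  n ∸ 1 + k * d                  ≤⟨ +-monoʳ-≤ (n ∸ 1) kd≤ ⟩
  n ∸ 1 + (k * p ∸ (n ∸ 1))      ≡⟨ m+[n∸m]≡n n≤ ⟩
  k * p                          ∎
  where
  open ≤-Reasoning
  a = k * p ∸ (n ∸ 1)
  sq-* : ∀ k d → k * d * (k * d) ≡ k * (k * 1) * (d * d)
  sq-* = solve-∀
  sq-2 : ∀ k p → k * (k * 1) * (2 * p) ≡ 2 * (k * (k * 1)) * p
  sq-2 = solve-∀
  kd≤ : k * d ≤ a
  kd≤ = ≮⇒≥ λ a<kd → <⇒≱ (*-mono-< a<kd a<kd) (begin
    k * d * (k * d)     ≡⟨ sq-* k d ⟩
    k ^ 2 * (d * d)     ≤⟨ *-monoʳ-≤ (k ^ 2) d²≤ ⟩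
    k ^ 2 * (2 * p)     ≡⟨ sq-2 k p ⟩
    2 * k ^ 2 * p       ≤⟨ sq ⟩
    a ^ 2               ≡⟨ cong (a *_) (*-identityʳ a) ⟩
    a * a               ∎)

theorem30 : (p : ℕ) → 4 ≤ p → (n : ℕ) → 0 < n →
    (F : Graph n) → IsForest F → (O : Orientation F) →
    (k : ℕ) → CeilBound p n k → ConvAtMost O p k
theorem30 p _ (suc n) _ G acyclic O k bound
  -- Here `d` is the integer part of √(2p): `d²≤` serves the budget and `2p<` the key claim.
  with integer-sqrt (2 * p) | spanning-tree G acyclic n (allFin (suc n)) (length-tabulate (λ i → i)) (allFin⁺ (suc n))
... | d , d²≤ , 2p< | r , F , σ , tree
  with decompose Fin._≟_ d p 2p< k r F (Unique-resp-↭ (↭-sym σ) (allFin⁺ (suc n)))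
         (subst (λ s → s + k * d ≤ k * p)
                (sym (suc-injective (trans (↭-length σ) (length-tabulate {n = suc n} (λ i → i)))))
                (CeilBound⇒budget p (suc n) k d d²≤ bound))
... | Xs , len , sizes , _ , odd =
  map toVSet Xs , subst (_≤ k) (sym (length-map toVSet Xs)) len ,
  All-map⁺ (All.map (λ {X} X≤ → ≤-trans (size-toVSet X) X≤) sizes) ,
  λ u v → trans (foldl-invert (Arc O) Xs u v) (reversed u v)
  where
  reversed : ∀ u v → (if flips Fin._≟_ Xs u v then Arc O v u else Arc O u v) ≡ Arc O v u
  reversed u v with Adj G u v Bool.≟ true
  ... | yes u~v = cong (if_then Arc O v u else Arc O u v) (odd-pair (tree (∈-allFin u) (∈-allFin v) u~v))
    where
    odd-pair : (u , v) ∈ edges r F ⊎ (v , u) ∈ edges r F → flips Fin._≟_ Xs u v ≡ true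
    odd-pair (inj₁ m) = odd m
    odd-pair (inj₂ m) = trans (flips-comm Xs u v) (odd m)
  -- Off the edges of `G` both arc values are `false`, so coverings of extra tree edges change
  -- nothing.
  ... | no u≁v = trans (cong (if flips Fin._≟_ Xs u v then Arc O v u else_) (trans (no-arc u v u≁v) (sym vu)))
                       (Bool.if-eta (flips Fin._≟_ Xs u v))
    where
    no-arc : ∀ a b → ¬ Adj G a b ≡ true → Arc O a b ≡ false
    no-arc a b a≁b = Bool.¬-not (λ q → a≁b (onEdges O a b q))
    vu : Arc O v u ≡ false
    vu = no-arc v u (λ q → u≁v (trans (Graph.sym G u v) q))
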